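{- For any $\mathcal{ELCD}$-formula $\varphi$, any relational model $N$ and any state $s$ of $N$: $N,s\Vdash\varphi$ if and only if $N^\rho,s\models\varphi$, where $N^\rho$ is the reverse translation of $N$.
   Context: Fix a countably infinite set $\mathsf{Prop}$ and a finite nonempty set $\mathsf{Ag}$ of agents; groups are nonempty subsets of $\mathsf{Ag}$. $\mathcal{ELCD}$-formulas: $\varphi::=p\mid\neg\varphi\mid(\varphi\to\varphi)\mid K_a\varphi\mid C_G\varphi\mid D_G\varphi$ ($p\in\mathsf{Prop}$, $a\in\mathsf{Ag}$, $G$ a group). $E_G\varphi:=\bigwedge_{a\in G}K_a\varphi$, $E_G^1\varphi:=E_G\varphi$, $E_G^{n}\varphi:=E_GE_G^{n-1}\varphi$. A model is a tuple $M=(W,A,E,C,\nu)$ with $W$ a nonempty set, $A$ an arbitrary set, $E:W\times W\to\wp(A)$, $C:\mathsf{Ag}\to\wp(A)$, $\nu:W\to\wp(\mathsf{Prop})$. Satisfaction: $M,s\models p$ iff $p\in\nu(s)$; Booleans as usual; $M,s\models K_a\psi$ iff for all $t\in W$, $C(a)\subseteq E(s,t)$ implies $M,t\models\psi$; $M,s\models C_G\psi$ iff $M,s\models E_G^n\psi$ for all $n\ge1$; $M,s\models D_G\psi$ iff for all $t\in W$, $\bigcup_{a\in G}C(a)\subseteq E(s,t)$ implies $M,t\models\psi$. A relational model is $N=(W,R,V)$ with $W$ nonempty, $R:\mathsf{Ag}\to\wp(W\times W)$ (arbitrary binary relations), $V:\mathsf{Prop}\to\wp(W)$. Satisfaction $\Vdash$: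 $N,s\Vdash p$ iff $s\in V(p)$; Booleans as usual; $N,s\Vdash K_a\psi$ iff for all $t$ with $(s,t)\in R(a)$, $N,t\Vdash\psi$; $N,s\Vdash C_G\psi$ iff $N,s\Vdash E_G^n\psi$ for all $n\ge1$; $N,s\Vdash D_G\psi$ iff for all $t$ with $(s,t)\in\bigcap_{a\in G}R(a)$, $N,t\Vdash\psi$. The reverse translation of $N=(W,R,V)$ is the model $N^\rho=(W,\mathsf{Ag},E,C,\nu)$ (the set of abilities is $\mathsf{Ag}$) with $E(s,t)=\{a\in\mathsf{Ag}\mid(s,t)\in R(a)\}$, $C(a)=\{a\}$, and $\nu(s)=\{p\in\mathsf{Prop}\mid s\in V(p)\}$. -}

module Defs where

open import Data.Empty using (⊥-elim-irr)
open import Data.Fin.Base using (Fin)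
open import Data.Fin.Subset using (Subset; Nonempty) renaming (_∈_ to _∈ₛ_)
open import Data.Fin.Subset.Properties using (_∈?_)
open import Data.List.Base using (List; []; _∷_; allFin; filter)
open import Data.List.Membership.Propositional using () renaming (_∈_ to _∈ₗ_)
open import Data.List.Membership.Propositional.Properties using (∈-filter⁺; ∈-allFin)
open import Data.List.NonEmpty as List⁺ using (List⁺; _∷_; foldr₁)
open import Data.Nat.Base using (ℕ; zero; suc; _≥_)
open import Data.Product.Base using (Σ-syntax; _×_; proj₁; proj₂) renaming (_,_ to ⟨_,_⟩)
open import Function.Bundles using (_↔_; _⇔_; Inverse; mk⇔)
open import Level using (Level; Lift; _⊔_; 0ℓ) renaming (suc to lsuc)
open import Relation.Binary.PropositionalEquality
  using (_≡_; _≢_; refl; cong; cong₂; trans; subst; sym)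
open import Relation.Unary using (Pred; _∈_; _⊆_; ｛_｝; ∁; _⇒_; ⋃; ⋂)

private
  variable
    ℓ w r v a e c : Level

record Signature : Set₁ where
  field
    Atom      : Set
    countable : Atom ↔ ℕ
    Ag        : Set
    size-1    : ℕ
    finite    : Ag ↔ Fin (suc size-1)

module Syntax (S : Signature) where
  open Signature S

  -- Subsets of Ag are subsets of its enumeration.  Irrelevance of the
  -- nonemptiness proof makes a group no more than its underlying subset.
  record Group : Set where
    constructor group
    field
      subset    : Subset (suc size-1)
      .nonempty : Nonempty subset

  open Group

  _∈ᴳ_ : Ag → Group → Set
  b ∈ᴳ G = Inverse.to finite b ∈ₛ subset G

  Member : Group → Set
  Member G = Σ[ b ∈ Ag ] b ∈ᴳ G

  members : Group → List⁺ Ag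
  members (group P P≢∅) = List⁺.map (Inverse.from finite) (list⁺ indices (inhabited P≢∅))
    where
    indices : List (Fin (suc size-1))
    indices = filter (_∈? P) (allFin _)

    inhabited : Nonempty P → indices ≢ []
    inhabited ⟨ i , i∈P ⟩ eq
      with () ← subst (i ∈ₗ_) eq (∈-filter⁺ (_∈? P) (∈-allFin i) i∈P)

    list⁺ : (is : List (Fin (suc size-1))) → .(is ≢ []) → List⁺ (Fin (suc size-1))
    list⁺ []       ≢[] = ⊥-elim-irr (≢[] refl)
    list⁺ (i ∷ is) _   = i ∷ is

  data Formula : Set where
    atom : Atom → Formula
    ¬′_  : Formula → Formula
    _→′_ : Formula → Formula → Formula
    K    : Ag → Formula → Formula
    C    : Group → Formula → Formula
    D    : Group → Formula → Formula

  -- E_G^n is a defined expression in ¬, → and K_a.  It is defined for any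
  -- interpretation of these three operations: for formulas it gives the
  -- abbreviation itself, for sets of states its truth set.
  record Operations (X : Set ℓ) : Set ℓ where
    field
      neg  : X → X
      imp  : X → X → X
      know : Ag → X → X

    -- Conjunction is not primitive: φ ∧ ψ abbreviates ¬ (φ → ¬ ψ).
    and : X → X → X
    and x y = neg (imp x (neg y))

    everyone : Group → X → X
    everyone G x = foldr₁ and (List⁺.map (λ b → know b x) (members G))

    everyone^ : Group → ℕ → X → X
    everyone^ G zero    x = x
    everyone^ G (suc n) x = everyone G (everyone^ G n x)

  open Operations

  formulas : Operations Formula
  formulas = record { neg = ¬′_ ; imp = _→′_ ; know = K }

  E : Group → Formula → Formula
  E = everyone formulas

  E^ : Group → ℕ → Formula → Formula
  E^ = everyone^ formulas

  module _ {X : Set ℓ} (O : Operations X) (h : Formula → X)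
           (h-neg  : ∀ φ → h (¬′ φ) ≡ neg O (h φ))
           (h-imp  : ∀ φ ψ → h (φ →′ ψ) ≡ imp O (h φ) (h ψ))
           (h-know : ∀ b φ → h (K b φ) ≡ know O b (h φ)) where

    everyone-homo : ∀ G φ → h (E G φ) ≡ everyone O G (h φ)
    everyone-homo G φ = go (List⁺.head (members G)) (List⁺.tail (members G))
      where
      go : ∀ b bs → h (foldr₁ (and formulas) (List⁺.map (λ b → K b φ) (b ∷ bs)))
                  ≡ foldr₁ (and O) (List⁺.map (λ b → know O b (h φ)) (b ∷ bs))
      go b []        = h-know b φ
      go b (b′ ∷ bs) =
        trans (h-neg _) (cong (neg O)
          (trans (h-imp _ _) (cong₂ (imp O) (h-know b φ)
            (trans (h-neg _) (cong (neg O) (go b′ bs))))))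

    everyone^-homo : ∀ G n φ → h (E^ G n φ) ≡ everyone^ O G n (h φ)
    everyone^-homo G zero    φ = refl
    everyone^-homo G (suc n) φ =
      trans (everyone-homo G (E^ G n φ)) (cong (everyone O G) (everyone^-homo G n φ))

module Semantics (S : Signature) where
  open Signature S
  open Syntax S
  open Operations

  record Model (w a e c v : Level) : Set (lsuc (w ⊔ a ⊔ e ⊔ c ⊔ v)) where
    field
      W        : Set w
      nonempty : W
      A        : Set a
      Edge     : W → W → Pred A e
      Cap      : Ag → Pred A c
      ν        : W → Pred Atom v

  record RelationalModel (w r v : Level) : Set (lsuc (w ⊔ r ⊔ v)) where
    field
      W        : Set w
      nonempty : W
      R        : Ag → Pred (W × W) r
      V        : Atom → Pred W v

  module _ (M : Model w a e c v) where
    open Model M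

    sets : Operations (Pred W (w ⊔ a ⊔ e ⊔ c ⊔ v))
    sets = record
      { neg  = ∁
      ; imp  = _⇒_
      ; know = λ b X s → ∀ t → Cap b ⊆ Edge s t → t ∈ X
      }

    ⟦_⟧ : Formula → Pred W (w ⊔ a ⊔ e ⊔ c ⊔ v)
    ⟦ atom p ⟧ s = Lift (w ⊔ a ⊔ e ⊔ c ⊔ v) (p ∈ ν s)
    ⟦ ¬′ φ   ⟧   = neg sets ⟦ φ ⟧
    ⟦ φ →′ ψ ⟧   = imp sets ⟦ φ ⟧ ⟦ ψ ⟧
    ⟦ K b φ  ⟧   = know sets b ⟦ φ ⟧
    ⟦ C G φ  ⟧ s = ∀ n → n ≥ 1 → s ∈ everyone^ sets G n ⟦ φ ⟧
    ⟦ D G φ  ⟧ s = ∀ t → (⋃[ m ∶ Member G ] Cap (proj₁ m)) ⊆ Edge s t → t ∈ ⟦ φ ⟧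

  module _ (N : RelationalModel w r v) where
    open RelationalModel N

    setsᴿ : Operations (Pred W (w ⊔ r ⊔ v))
    setsᴿ = record
      { neg  = ∁
      ; imp  = _⇒_
      ; know = λ b X s → ∀ t → ⟨ s , t ⟩ ∈ R b → t ∈ X
      }

    ⟦_⟧ᴿ : Formula → Pred W (w ⊔ r ⊔ v)
    ⟦ atom p ⟧ᴿ s = Lift (w ⊔ r ⊔ v) (s ∈ V p)
    ⟦ ¬′ φ   ⟧ᴿ   = neg setsᴿ ⟦ φ ⟧ᴿ
    ⟦ φ →′ ψ ⟧ᴿ   = imp setsᴿ ⟦ φ ⟧ᴿ ⟦ ψ ⟧ᴿ
    ⟦ K b φ  ⟧ᴿ   = know setsᴿ b ⟦ φ ⟧ᴿ
    ⟦ C G φ  ⟧ᴿ s = ∀ n → n ≥ 1 → s ∈ everyone^ setsᴿ G n ⟦ φ ⟧ᴿ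
    ⟦ D G φ  ⟧ᴿ s = ∀ t → ⟨ s , t ⟩ ∈ (⋂[ m ∶ Member G ] R (proj₁ m)) → t ∈ ⟦ φ ⟧ᴿ

  infix 3 _,_⊨_ _,_⊩_

  _,_⊨_ : (M : Model w a e c v) → Model.W M → Formula → Set (w ⊔ a ⊔ e ⊔ c ⊔ v)
  M , s ⊨ φ = s ∈ ⟦_⟧ M φ

  _,_⊩_ : (N : RelationalModel w r v) → RelationalModel.W N → Formula → Set (w ⊔ r ⊔ v)
  N , s ⊩ φ = s ∈ ⟦_⟧ᴿ N φ

  -- The C_G clauses above avoid a non-structural recursive call on E_G^n φ;
  -- they agree with satisfaction of the formulas E_G^n φ.
  ⊨-C : (M : Model w a e c v) → ∀ s G φ →
        (M , s ⊨ C G φ) ⇔ (∀ n → n ≥ 1 → M , s ⊨ E^ G n φ)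
  ⊨-C M s G φ = mk⇔
    (λ f n n≥1 → subst (s ∈_) (sym (eq n)) (f n n≥1))
    (λ f n n≥1 → subst (s ∈_) (eq n) (f n n≥1))
    where
    eq : ∀ n → ⟦_⟧ M (E^ G n φ) ≡ everyone^ (sets M) G n (⟦_⟧ M φ)
    eq n = everyone^-homo (sets M) (⟦_⟧ M)
             (λ _ → refl) (λ _ _ → refl) (λ _ _ → refl) G n φ

  ⊩-C : (N : RelationalModel w r v) → ∀ s G φ →
        (N , s ⊩ C G φ) ⇔ (∀ n → n ≥ 1 → N , s ⊩ E^ G n φ)
  ⊩-C N s G φ = mk⇔
    (λ f n n≥1 → subst (s ∈_) (sym (eq n)) (f n n≥1))
    (λ f n n≥1 → subst (s ∈_) (eq n) (f n n≥1))
    where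
    eq : ∀ n → ⟦_⟧ᴿ N (E^ G n φ) ≡ everyone^ (setsᴿ N) G n (⟦_⟧ᴿ N φ)
    eq n = everyone^-homo (setsᴿ N) (⟦_⟧ᴿ N)
             (λ _ → refl) (λ _ _ → refl) (λ _ _ → refl) G n φ

  infix 10 _^ρ

  _^ρ : RelationalModel w r v → Model w 0ℓ r 0ℓ v
  N ^ρ = record
    { W        = W
    ; nonempty = nonempty
    ; A        = Ag
    ; Edge     = λ s t b → ⟨ s , t ⟩ ∈ R b
    ; Cap      = ｛_｝
    ; ν        = λ s p → s ∈ V p
    }
    where open RelationalModel N

{-# OPTIONS --safe #-}
module Submission where

open import Defs
open import Level using (Level)
open import Function.Bundles using (_⇔_; Equivalence; mk⇔)
open import Data.List.Base using ([]; _∷_)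
open import Data.List.NonEmpty as List⁺ using (_∷_; foldr₁)
open import Data.Nat.Base using (zero; suc)
open import Data.Product.Base using (proj₁; _,_)
open import Function.Construct.Identity using (⇔-id)
open import Function.Related.TypeIsomorphisms using (→-cong-⇔; ¬-cong-⇔)
open import Relation.Binary.Core using (REL)
open import Relation.Binary.PropositionalEquality using (refl)
open import Relation.Unary using (Pred; _∈_; _⊆_; ｛_｝; ⋃)

-- The singleton capacities of N ^ρ turn Cap b ⊆ Edge s t into R b (s , t), and
-- hence unions of capacities into intersections of relations, so each clause
-- of ⊨ over N ^ρ is the corresponding clause of ⊩ over N.

private
  variable
    a i ℓ : Level

Π-cong-⇔ : {A : Set a} {P Q : Pred A ℓ} → (∀ x → P x ⇔ Q x) → (∀ x → P x) ⇔ (∀ x → Q x)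
Π-cong-⇔ P⇔Q = mk⇔ (λ f x → Equivalence.to (P⇔Q x) (f x))
                   (λ f x → Equivalence.from (P⇔Q x) (f x))

｛｝⊆-⇔ : {A : Set a} (P : Pred A ℓ) (x : A) → x ∈ P ⇔ ｛ x ｝ ⊆ P
｛｝⊆-⇔ P x = mk⇔ (λ { x∈P refl → x∈P }) (λ x⊆P → x⊆P refl)

-- An element of the union is an index `j` with a proof that `f j` equals it; matching on `refl`
-- leaves only the index. With `P` the set of agents relating two states, the left side is
-- membership in an intersection of relations.
⋃｛｝⊆-⇔ : {A : Set a} {I : Set i} (P : Pred A ℓ) (f : I → A) →
           (∀ j → f j ∈ P) ⇔ ⋃ I (λ j → ｛ f j ｝) ⊆ P
⋃｛｝⊆-⇔ P f = mk⇔ (λ { fj∈P (j , refl) → fj∈P j }) (λ ⋃⊆P j → ⋃⊆P (j , refl))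

module _ (S : Signature) where
  open Syntax S
  open Semantics S
  open Operations

  module _ {x y} {X : Set x} {Y : Set y} (O : Operations X) (O′ : Operations Y)
           (_∼_ : REL X Y ℓ)
           (neg-resp  : ∀ {x y} → x ∼ y → neg O x ∼ neg O′ y)
           (imp-resp  : ∀ {x x′ y y′} → x ∼ y → x′ ∼ y′ → imp O x x′ ∼ imp O′ y y′)
           (know-resp : ∀ b {x y} → x ∼ y → know O b x ∼ know O′ b y) where

    -- A logical-relations argument: both sides fold the same list `members G` by expressions in the
    -- three operations, each of which preserves `_∼_`.
    everyone-resp : ∀ G {x y} → x ∼ y → everyone O G x ∼ everyone O′ G y
    everyone-resp G {x} {y} x∼y = go (List⁺.head (members G)) (List⁺.tail (members G))
      where
      go : ∀ b bs → foldr₁ (and O) (List⁺.map (λ b → know O b x) (b ∷ bs))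
                  ∼ foldr₁ (and O′) (List⁺.map (λ b → know O′ b y) (b ∷ bs))
      go b []        = know-resp b x∼y
      -- `and` unfolds to `neg (imp x (neg y))`, hence the two uses of `neg-resp`.
      go b (b′ ∷ bs) = neg-resp (imp-resp (know-resp b x∼y) (neg-resp (go b′ bs)))

    everyone^-resp : ∀ G n {x y} → x ∼ y → everyone^ O G n x ∼ everyone^ O′ G n y
    everyone^-resp G zero    x∼y = x∼y
    everyone^-resp G (suc n) x∼y = everyone-resp G (everyone^-resp G n x∼y)

  module _ {w r v} (N : RelationalModel w r v) where
    open RelationalModel N

    -- The equivalence is assumed at every state because `know` at `s` inspects other states.
    know-ρ : ∀ b {P Q} → (∀ s → s ∈ P ⇔ s ∈ Q) →
             ∀ s → s ∈ know (setsᴿ N) b P ⇔ s ∈ know (sets (N ^ρ)) b Q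
    know-ρ b P⇔Q s = Π-cong-⇔ λ t → →-cong-⇔ (｛｝⊆-⇔ _ b) (P⇔Q t)

    everyone^-ρ : ∀ G n {P Q} → (∀ s → s ∈ P ⇔ s ∈ Q) →
                  ∀ s → s ∈ everyone^ (setsᴿ N) G n P ⇔ s ∈ everyone^ (sets (N ^ρ)) G n Q
    everyone^-ρ = everyone^-resp (setsᴿ N) (sets (N ^ρ)) (λ P Q → ∀ s → s ∈ P ⇔ s ∈ Q)
      (λ P⇔Q s → ¬-cong-⇔ (P⇔Q s))
      (λ P⇔Q P′⇔Q′ s → →-cong-⇔ (P⇔Q s) (P′⇔Q′ s))
      know-ρ

    ⊩⇔⊨ρ : ∀ φ s → (N , s ⊩ φ) ⇔ (N ^ρ , s ⊨ φ)
    -- The two `Lift`s have the same level, since `0ℓ` is absorbed in the join.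
    ⊩⇔⊨ρ (atom p) s = ⇔-id _
    ⊩⇔⊨ρ (¬′ φ)   s = ¬-cong-⇔ (⊩⇔⊨ρ φ s)
    ⊩⇔⊨ρ (φ →′ ψ) s = →-cong-⇔ (⊩⇔⊨ρ φ s) (⊩⇔⊨ρ ψ s)
    ⊩⇔⊨ρ (K b φ)  s = know-ρ b (⊩⇔⊨ρ φ) s
    -- `E^ G n φ` is no subformula of `C G φ`, so the induction hypothesis is used on `φ` only and
    -- carried through the iterates on sets of states.
    ⊩⇔⊨ρ (C G φ)  s = Π-cong-⇔ λ n → →-cong-⇔ (⇔-id _) (everyone^-ρ G n (⊩⇔⊨ρ φ) s)
    ⊩⇔⊨ρ (D G φ)  s = Π-cong-⇔ λ t → →-cong-⇔ (⋃｛｝⊆-⇔ _ proj₁) (⊩⇔⊨ρ φ t)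

lemma17 : (S : Signature) → let open Syntax S in let open Semantics S in
    ∀ {w r v : Level} (φ : Formula) (N : RelationalModel w r v) (s : RelationalModel.W N) →
    (N , s ⊩ φ) ⇔ (N ^ρ , s ⊨ φ)
lemma17 S φ N s = ⊩⇔⊨ρ S N φ s
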